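{- The sets of patterns $\{112,2212\}$ and $\{121,2122\}$ are $m$-equivalent, that is, $\{112,2212\}\sim\{121,2122\}$.
   Context: A (finite, reduced) multiset is $S=1^{a_1}2^{a_2}\cdots k^{a_k}$ with $k\ge 1$ and all $a_i\ge 1$, meaning that $i$ occurs with multiplicity $a_i$. A multipermutation of $S$ is a word having exactly $a_i$ occurrences of each letter $i\in[k]=\{1,\dots,k\}$ and no other letters. A word $\pi=\pi_1\cdots\pi_n$ contains a pattern (word) $\rho=\rho_1\cdots\rho_\ell$ if there are indices $i(1)<\cdots<i(\ell)$ such that for all $a,b\in[\ell]$: $\pi_{i(a)}<\pi_{i(b)}$ iff $\rho_a<\rho_b$, and $\pi_{i(a)}>\pi_{i(b)}$ iff $\rho_a>\rho_b$; otherwise $\pi$ avoids $\rho$. For a set $P$ of patterns, $\mathrm{av}(S;P)$ is the number of multipermutations of $S$ that avoid every pattern in $P$. Two sets of patterns $P,Q$ are $m$-equivalent, written here $P\sim Q$, if $\mathrm{av}(S;P)=\mathrm{av}(S;Q)$ for every multiset $S$. -}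

module Defs where

open import Data.Fin using (Fin; _<_; _>_)
open import Data.Fin.Properties using (_≟_; _<?_; all?; any?)
open import Data.List using (List; []; _∷_; length; filter; allFin; cartesianProductWith)
import Data.List as List
open import Data.List.Membership.Propositional using (_∈_)
open import Data.List.Membership.Propositional.Properties using (∈-allFin; ∈-cartesianProductWith⁺)
open import Data.List.Relation.Unary.All using (All)
import Data.List.Relation.Unary.All as All
open import Data.List.Relation.Unary.Any using (here)
open import Data.List.Relation.Unary.Unique.Propositional using (Unique)
import Data.List.Relation.Unary.Unique.Propositional.Properties as Unique
open import Data.List.Relation.Unary.AllPairs using ([]; _∷_)
open import Data.Nat using (ℕ; zero; suc)
import Data.Nat as ℕ
open import Data.Product using (∃; _×_; _,_)
open import Data.Vec using (Vec; []; _∷_; lookup; count; sum)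
import Data.Vec.Properties as Vec
open import Function using (_⇔_; mk⇔; Equivalence)
open import Relation.Binary.PropositionalEquality using (_≡_; refl)
open import Relation.Nullary using (Dec; ¬_; ¬?; _×-dec_; _→-dec_; map′)
open import Relation.Unary using (Decidable)

record Multiset : Set where
  field
    k    : ℕ
    a    : Vec ℕ k
    k≥1  : 1 ℕ.≤ k
    aᵢ≥1 : ∀ i → 1 ℕ.≤ lookup a i

  size : ℕ
  size = sum a

open Multiset

-- The letters 1 < 2 < ⋯ < k are represented by the elements 0 < 1 < ⋯ < k - 1
-- of Fin k.
Word : ℕ → ℕ → Set
Word k n = Vec (Fin k) n

-- Every word with the prescribed multiplicities has length size S, so fixing
-- the length excludes nothing; letters outside [k] are excluded by the type.
IsMultipermutation : (S : Multiset) → Word (k S) (size S) → Set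
IsMultipermutation S π = ∀ i → count (i ≟_) π ≡ lookup (a S) i

Pattern : Set
Pattern = List ℕ

IsOccurrence : ∀ {k n} → Word k n → (ρ : Pattern) → Vec (Fin n) (length ρ) → Set
IsOccurrence π ρ i =
  (∀ a b → a < b → lookup i a < lookup i b) ×
  (∀ a b →
    (lookup π (lookup i a) < lookup π (lookup i b) ⇔ List.lookup ρ a ℕ.< List.lookup ρ b) ×
    (lookup π (lookup i a) > lookup π (lookup i b) ⇔ List.lookup ρ a ℕ.> List.lookup ρ b))

Contains : ∀ {k n} → Word k n → Pattern → Set
Contains π ρ = ∃ (IsOccurrence π ρ)

Avoids : ∀ {k n} → Word k n → Pattern → Set
Avoids π ρ = ¬ Contains π ρ

⇔-dec : ∀ {A B : Set} → Dec A → Dec B → Dec (A ⇔ B)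
⇔-dec A? B? = map′ (λ (f , g) → mk⇔ f g)
                   (λ e → Equivalence.to e , Equivalence.from e)
                   ((A? →-dec B?) ×-dec (B? →-dec A?))

anyVec? : ∀ {m n} {P : Vec (Fin m) n → Set} → Decidable P → Dec (∃ P)
anyVec? {n = zero}  P? = map′ (λ p → [] , p) (λ { ([] , p) → p }) (P? [])
anyVec? {n = suc n} P? = map′ (λ (x , xs , p) → (x ∷ xs) , p)
                              (λ { ((x ∷ xs) , p) → x , xs , p })
                              (any? λ x → anyVec? λ xs → P? (x ∷ xs))

isMultipermutation? : ∀ S → Decidable (IsMultipermutation S)
isMultipermutation? S π = all? λ i → count (i ≟_) π ℕ.≟ lookup (a S) i

isOccurrence? : ∀ {k n} (π : Word k n) ρ → Decidable (IsOccurrence π ρ)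
isOccurrence? π ρ i =
  (all? λ a → all? λ b → (a <? b) →-dec (lookup i a <? lookup i b)) ×-dec
  (all? λ a → all? λ b →
    ⇔-dec (lookup π (lookup i a) <? lookup π (lookup i b))
          (List.lookup ρ a ℕ.<? List.lookup ρ b) ×-dec
    ⇔-dec (lookup π (lookup i b) <? lookup π (lookup i a))
          (List.lookup ρ b ℕ.<? List.lookup ρ a))

avoids? : ∀ {k n} (π : Word k n) → Decidable (Avoids π)
avoids? π ρ = ¬? (anyVec? (isOccurrence? π ρ))

allWords : ∀ k n → List (Word k n)
allWords k zero    = [] ∷ []
allWords k (suc n) = cartesianProductWith _∷_ (allFin k) (allWords k n)

-- allWords lists every word exactly once, so the length of a filtered
-- sublist is the number of words satisfying the predicate.
∈-allWords : ∀ {k n} (w : Word k n) → w ∈ allWords k n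
∈-allWords []      = here refl
∈-allWords (x ∷ w) = ∈-cartesianProductWith⁺ _∷_ (∈-allFin x) (∈-allWords w)

allWords-unique : ∀ k n → Unique (allWords k n)
allWords-unique k zero    = All.[] ∷ []
allWords-unique k (suc n) =
  Unique.cartesianProductWith⁺ _∷_ Vec.∷-injective (Unique.allFin⁺ k) (allWords-unique k n)

AvoidingMultipermutation : (S : Multiset) → List Pattern → Word (k S) (size S) → Set
AvoidingMultipermutation S P π = IsMultipermutation S π × All (Avoids π) P

avoidingMultipermutation? : ∀ S P → Decidable (AvoidingMultipermutation S P)
avoidingMultipermutation? S P π = isMultipermutation? S π ×-dec All.all? (avoids? π) P

av : Multiset → List Pattern → ℕ
av S P = length (filter (avoidingMultipermutation? S P) (allWords (k S) (size S)))

infix 4 _∼_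

_∼_ : List Pattern → List Pattern → Set
P ∼ Q = ∀ S → av S P ≡ av S Q

{-# OPTIONS --safe #-}

-- Delete the copies of the smallest letter 0, of multiplicity n + 1, from a
-- word avoiding 112 and 2212: what remains, u v, avoids both patterns, and the
-- word is u 0 v 0ⁿ.  After reversal the other pair becomes {121, 2212}, and the
-- corresponding shape is u 0 0ⁿ v.  In both cases the only constraint on the
-- cut u | v is that 0 must not complete a pattern 2212, and this forces the
-- occurrences of each letter after its first to form one uncut block.  A letter
-- thus contributes one or two blocks, according to whether its multiplicity
-- exceeds one, so the number of admissible cuts depends only on the multiset
-- and the two classes are enumerated by the same codes.
module Submission where

open import Defs
open import Data.Bool using (true; false)
open import Data.Empty using (⊥)
open import Data.Fin as Fin using (Fin; zero; suc; toℕ)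
import Data.Fin.Properties as Fin
open import Data.List using (List; []; _∷_; _++_; map; filter; length; replicate; reverse;
  concatMap; take; drop; allFin; cartesianProduct)
import Data.List as List
open import Data.List.Properties
open import Data.List.Membership.Propositional using (_∈_)
open import Data.List.Membership.Propositional.Properties
open import Data.List.Relation.Binary.Permutation.Propositional.Properties using (↭-length; ↭-reverse; filter-↭)
open import Data.List.Relation.Binary.BagAndSetEquality using (∼bag⇒↭)
open import Data.List.Membership.Propositional.Properties.WithK using (unique∧set⇒bag)
open import Data.List.Relation.Binary.Sublist.Heterogeneous.Core using (Sublist; []; _∷_; _∷ʳ_)
import Data.List.Relation.Unary.All as All
open All using (All; []; _∷_)
import Data.List.Relation.Unary.All.Properties as All
import Data.List.Relation.Unary.Any as Any
open import Data.List.Relation.Unary.Any.Properties using (lookup-index)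
open Any using (here)
open import Data.List.Relation.Unary.AllPairs using ([]; _∷_)
open import Data.List.Relation.Unary.Unique.Propositional using (Unique)
import Data.List.Relation.Unary.Unique.Propositional.Properties as Unique
open import Data.Nat using (ℕ; zero; suc; pred; _+_; _≤_; _<_; z≤n; s≤s; z<s)
open import Data.Nat.ListAction using (sum)
import Data.Nat.Properties as ℕ
open import Data.Product using (∃; ∃₂; _×_; _,_; proj₁; proj₂)
open import Data.Sum using (_⊎_; inj₁; inj₂)
open import Data.Unit using (⊤; tt)
open import Data.Vec using (Vec; []; _∷_; lookup; toList; fromList)
import Data.Vec as Vec
import Data.Vec.Properties as Vec
open import Function using (_∘_; _⇔_; mk⇔; Equivalence; id; case_of_)
open import Relation.Binary using (tri<; tri≈; tri>)
open import Relation.Binary.PropositionalEquality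
open import Relation.Nullary using (¬_; yes; no; contradiction; does)
open import Relation.Unary using (Decidable)

private variable
  k m n r s : ℕ
  A B : Set

-- Patterns with a single letter c amid copies of a letter d

occ : Fin k → List (Fin k) → ℕ
occ i w = length (filter (i Fin.≟_) w)

occ-++ : (i : Fin k) → ∀ v w → occ i (v ++ w) ≡ occ i v + occ i w
occ-++ i v w = trans (cong length (filter-++ (i Fin.≟_) v w)) (length-++ (filter (i Fin.≟_) v))

occ-here : (i : Fin k) → ∀ w → occ i (i ∷ w) ≡ suc (occ i w)
occ-here i w = cong length (filter-accept (i Fin.≟_) {xs = w} refl)

occ-there : {i x : Fin k} → i ≢ x → ∀ w → occ i (x ∷ w) ≡ occ i w
occ-there i≢x w = cong length (filter-reject (_ Fin.≟_) {xs = w} i≢x)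

occ-∷ : (i x : Fin k) → ∀ w → occ i w ≤ occ i (x ∷ w)
occ-∷ i x w with does (i Fin.≟ x)
... | true  = ℕ.n≤1+n _
... | false = ℕ.≤-refl

occ-reverse : (i : Fin k) → ∀ w → occ i (reverse w) ≡ occ i w
occ-reverse i w = ↭-length (filter-↭ (i Fin.≟_) (↭-reverse w))

occ-replicate-here : (i : Fin k) → ∀ m → occ i (replicate m i) ≡ m
occ-replicate-here i zero    = refl
occ-replicate-here i (suc m) = trans (occ-here i (replicate m i)) (cong suc (occ-replicate-here i m))

occ-replicate-there : {i x : Fin k} → i ≢ x → ∀ m → occ i (replicate m x) ≡ 0
occ-replicate-there i≢x zero    = refl
occ-replicate-there i≢x (suc m) = trans (occ-there i≢x (replicate m _)) (occ-replicate-there i≢x m)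

occ-toList : (i : Fin k) (π : Word k n) → occ i (toList π) ≡ Vec.count (i Fin.≟_) π
occ-toList i []      = refl
occ-toList i (x ∷ π) with does (i Fin.≟ x)
... | true  = cong suc (occ-toList i π)
... | false = occ-toList i π

-- The letter c occurs once in the pattern, so an occurrence amounts to a position of c together
-- with enough copies of d on either side. The order of d and c is imposed separately.
record Around (r s : ℕ) (d c : Fin k) (w : List (Fin k)) : Set where
  constructor around
  field
    before after : List (Fin k)
    w≡           : w ≡ before ++ c ∷ after
    r≤           : r ≤ occ d before
    s≤           : s ≤ occ d after

around-∷ : ∀ {d c : Fin k} {w} x → Around r s d c w → Around r s d c (x ∷ w)
around-∷ {d = d} x (around p q refl r≤ s≤) =
  around (x ∷ p) q refl (ℕ.≤-trans r≤ (occ-∷ d x p)) s≤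

around-suc : ∀ {d c : Fin k} {w} → Around r s d c w → Around (suc r) s d c (d ∷ w)
around-suc {d = d} (around p q refl r≤ s≤) =
  around (d ∷ p) q refl (subst (_ ≤_) (sym (occ-here d p)) (s≤s r≤)) s≤

around-reverse : ∀ {d c : Fin k} {w} → Around r s d c w → Around s r d c (reverse w)
around-reverse {d = d} {c} (around p q refl r≤ s≤) =
  around (reverse q) (reverse p)
    (begin
      reverse (p ++ c ∷ q)                ≡⟨ reverse-++ p (c ∷ q) ⟩
      reverse (c ∷ q) ++ reverse p        ≡⟨ cong (_++ reverse p) (unfold-reverse c q) ⟩
      (reverse q ++ c ∷ []) ++ reverse p  ≡⟨ ++-assoc (reverse q) (c ∷ []) (reverse p) ⟩
      reverse q ++ c ∷ reverse p          ∎)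
    (subst (_ ≤_) (sym (occ-reverse d q)) s≤)
    (subst (_ ≤_) (sym (occ-reverse d p)) r≤)
  where open ≡-Reasoning

-- The four patterns arise for `r s D C` equal to 2 0 1 2 (112), 2 1 2 1 (2212), 1 1 1 2 (121) and 1
-- 2 2 1 (2122).
surround : ℕ → ℕ → ℕ → ℕ → Pattern
surround r s D C = replicate r D ++ C ∷ replicate s D

module _ {R : ℕ → Fin k → Set} {D C : ℕ} {d c : Fin k} where

  match⇒occ : (∀ {x} → R D x → x ≡ d) → ∀ {s w} → Sublist R (replicate s D) w → s ≤ occ d w
  match⇒occ D⇒d {zero}  _       = z≤n
  match⇒occ D⇒d {suc s} (x ∷ʳ σ) = ℕ.≤-trans (match⇒occ D⇒d σ) (occ-∷ d x _)
  match⇒occ D⇒d {suc s} (_∷_ {ys = w} Rx σ) with refl ← D⇒d Rx =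
    subst (_ ≤_) (sym (occ-here d w)) (s≤s (match⇒occ D⇒d σ))

  occ⇒match : R D d → ∀ {s} w → s ≤ occ d w → Sublist R (replicate s D) w
  occ⇒match RDd {zero}  []      _  = []
  occ⇒match RDd {zero}  (x ∷ w) s≤ = x ∷ʳ occ⇒match RDd w z≤n
  occ⇒match RDd {suc s} (x ∷ w) s≤ with d Fin.≟ x
  ... | yes refl = RDd ∷ occ⇒match RDd w (ℕ.≤-pred s≤)
  ... | no  d≢x  = x ∷ʳ occ⇒match RDd w s≤

  -- The position matched with `C` is the centre of the split; the letters matched with copies of
  -- `D` before and after it bound the two counts from below.
  match⇒around : (∀ {x} → R D x → x ≡ d) → (∀ {x} → R C x → x ≡ c) →
                 ∀ {r s w} → Sublist R (surround r s D C) w → Around r s d c w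
  match⇒around D⇒d C⇒c {zero}  (x ∷ʳ σ) = around-∷ x (match⇒around D⇒d C⇒c σ)
  match⇒around D⇒d C⇒c {zero}  (_∷_ {ys = w} Rx σ) with refl ← C⇒c Rx =
    around [] w refl z≤n (match⇒occ D⇒d σ)
  match⇒around D⇒d C⇒c {suc r} (x ∷ʳ σ) = around-∷ x (match⇒around D⇒d C⇒c σ)
  match⇒around D⇒d C⇒c {suc r} (Rx ∷ σ) with refl ← D⇒d Rx =
    around-suc (match⇒around D⇒d C⇒c σ)

  around⇒match : R D d → R C c → ∀ {r s w} → Around r s d c w → Sublist R (surround r s D C) w
  around⇒match RDd RCc (around p q refl r≤ s≤) = go _ p r≤
    where
    go : ∀ r p → r ≤ occ d p → Sublist R (surround r _ D C) (p ++ c ∷ q)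
    go zero    []      r≤ = RCc ∷ occ⇒match RDd q s≤
    go zero    (x ∷ p) r≤ = x ∷ʳ go zero p z≤n
    go (suc r) (x ∷ p) r≤ with d Fin.≟ x
    ... | yes refl = RDd ∷ go r p (ℕ.≤-pred r≤)
    ... | no  d≢x  = x ∷ʳ go (suc r) p r≤

-- Increasing position vectors as inductive embeddings

Increasing : Vec (Fin n) m → Set
Increasing is = ∀ a b → a Fin.< b → lookup is a Fin.< lookup is b

lower : (is : Vec (Fin (suc n)) m) → (∀ a → zero {n} Fin.< lookup is a) → ∃ λ js → is ≡ Vec.map suc js
lower []           0<  = [] , refl
lower (zero ∷ is)  0<  = contradiction (0< zero) λ ()
lower (suc i ∷ is) 0< with js , refl ← lower is (0< ∘ suc) = i ∷ js , refl

increasing-map⁻ : (is : Vec (Fin n) m) → Increasing (Vec.map suc is) → Increasing is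
increasing-map⁻ is incr a b a<b =
  ℕ.≤-pred (subst₂ Fin._<_ (Vec.lookup-map a suc is) (Vec.lookup-map b suc is) (incr a b a<b))

increasing-map⁺ : (is : Vec (Fin n) m) → Increasing is → Increasing (Vec.map suc is)
increasing-map⁺ is incr a b a<b =
  subst₂ Fin._<_ (sym (Vec.lookup-map a suc is)) (sym (Vec.lookup-map b suc is)) (s≤s (incr a b a<b))

module _ {R : A → B → Set} where

  Matches : List A → Vec B n → Set
  Matches {n} ρ π = ∃ λ (is : Vec (Fin n) (length ρ)) →
    Increasing is × (∀ a → R (List.lookup ρ a) (lookup π (lookup is a)))

  lookup-shift : ∀ x (π : Vec B n) ρ (is : Vec (Fin n) (length ρ)) →
    (∀ a → R (List.lookup ρ a) (lookup π (lookup is a))) ⇔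
    (∀ a → R (List.lookup ρ a) (lookup (x ∷ π) (lookup (Vec.map suc is) a)))
  lookup-shift x π ρ is = mk⇔
    (λ f a → subst (λ i → R (List.lookup ρ a) (lookup (x ∷ π) i)) (sym (Vec.lookup-map a suc is)) (f a))
    (λ f a → subst (λ i → R (List.lookup ρ a) (lookup (x ∷ π) i)) (Vec.lookup-map a suc is) (f a))

  matches⇒sublist : ∀ ρ (π : Vec B n) → Matches ρ π → Sublist R ρ (toList π)
  matches⇒sublist []      []      _ = []
  matches⇒sublist []      (x ∷ π) _ = x ∷ʳ matches⇒sublist [] π ([] , (λ ()) , λ ())
  matches⇒sublist (p ∷ ρ) []      ((() ∷ _) , _)
  matches⇒sublist (p ∷ ρ) (x ∷ π) ((i ∷ is) , incr , f)
    -- The later positions exceed the first one, hence are positive and can all be shifted down to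
    -- the tail of the word.
    with js , refl ← lower is (λ a → ℕ.≤-<-trans z≤n (incr zero (suc a) (s≤s z≤n)))
    with i
  ... | zero  = f zero ∷ matches⇒sublist ρ π
                  (js , increasing-map⁻ js (λ a b a<b → incr (suc a) (suc b) (s≤s a<b)) ,
                   Equivalence.from (lookup-shift x π ρ js) (f ∘ suc))
  ... | suc i = x ∷ʳ matches⇒sublist (p ∷ ρ) π
                  (i ∷ js , increasing-map⁻ (i ∷ js) incr , Equivalence.from (lookup-shift x π (p ∷ ρ) (i ∷ js)) f)

  sublist⇒matches : ∀ ρ (π : Vec B n) → Sublist R ρ (toList π) → Matches ρ π
  sublist⇒matches []      []      []       = [] , (λ ()) , λ ()
  sublist⇒matches ρ       (x ∷ π) (.x ∷ʳ σ) with is , incr , f ← sublist⇒matches ρ π σ =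
    Vec.map suc is , increasing-map⁺ is incr , Equivalence.to (lookup-shift x π ρ is) f
  sublist⇒matches (p ∷ ρ) (x ∷ π) (Rx ∷ σ) with is , incr , f ← sublist⇒matches ρ π σ =
    zero ∷ Vec.map suc is , incr′ , λ { zero → Rx ; (suc a) → Equivalence.to (lookup-shift x π ρ is) f a }
    where
    incr′ : Increasing (zero ∷ Vec.map suc is)
    incr′ zero    (suc b) _         = subst (λ j → 0 < toℕ j) (sym (Vec.lookup-map b suc is)) z<s
    incr′ (suc a) (suc b) (s≤s a<b) = increasing-map⁺ is incr a b a<b

-- Order isomorphism with two-letter patterns

SameOrder : ℕ → ℕ → Fin k → Fin k → Set
SameOrder p q x y = (x Fin.< y ⇔ p < q) × (y Fin.< x ⇔ q < p)

sameOrder-refl : ∀ p (x : Fin k) → SameOrder p p x x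
sameOrder-refl p x = both , both
  where
  both : x Fin.< x ⇔ p < p
  both = mk⇔ (λ x<x → contradiction x<x (ℕ.<-irrefl refl)) (λ p<p → contradiction p<p (ℕ.<-irrefl refl))

sameOrder-≡ : ∀ {p} {x y : Fin k} → SameOrder p p x y → x ≡ y
sameOrder-≡ {x = x} {y} (lt , gt) with Fin.<-cmp x y
... | tri< x<y _ _ = contradiction (Equivalence.to lt x<y) (ℕ.<-irrefl refl)
... | tri≈ _ x≡y _ = x≡y
... | tri> _ _ y<x = contradiction (Equivalence.to gt y<x) (ℕ.<-irrefl refl)

module _ {D C : ℕ} (D≢C : D ≢ C) (π : Word k n) where

  -- With d and c fixed, the comparison of all pairs of positions reduces to this condition on
  -- single positions, which is what an embedding can carry.
  LetterFor : Fin k → Fin k → ℕ → Fin k → Set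
  LetterFor d c p x = (p ≡ D × x ≡ d) ⊎ (p ≡ C × x ≡ c)

  -- Letters matched with equal pattern entries are equal, so every letter of an occurrence
  -- coincides with the one found at a fixed copy of `D` or at the copy of `C`.
  contains⇒around : Contains π (surround (suc r) s D C) →
                    ∃₂ λ d c → SameOrder D C d c × Around (suc r) s d c (toList π)
  contains⇒around {r} {s} (is , incr , order) =
    d , c , subst (λ p → SameOrder D p d c) (sym ρf≡C) (order zero f) ,
    match⇒around {R = LetterFor d c}
      (λ { (inj₁ (_ , x≡d)) → x≡d ; (inj₂ (D≡C , _)) → contradiction D≡C D≢C })
      (λ { (inj₁ (C≡D , _)) → contradiction (sym C≡D) D≢C ; (inj₂ (_ , x≡c)) → x≡c })
      (matches⇒sublist ρ π (is , incr , letters))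
    where
    ρ = surround (suc r) s D C

    C∈ρ : C ∈ ρ
    C∈ρ = ∈-++⁺ʳ (replicate (suc r) D) (here refl)

    f = Any.index C∈ρ
    ρf≡C : C ≡ List.lookup ρ f
    ρf≡C = lookup-index C∈ρ

    letter : Fin (length ρ) → Fin k
    letter a = lookup π (lookup is a)

    -- Index 0 carries `D`, since the pattern starts with at least one copy of it.
    d = letter zero
    c = letter f

    DorC : All (λ p → p ≡ D ⊎ p ≡ C) ρ
    DorC = All.++⁺ (All.replicate⁺ (suc r) (inj₁ refl)) (inj₂ refl ∷ All.replicate⁺ s (inj₁ refl))

    letters : ∀ a → LetterFor d c (List.lookup ρ a) (letter a)
    letters a with All.lookup DorC (∈-lookup {xs = ρ} a)
    ... | inj₁ ρa≡D = inj₁ (ρa≡D , sameOrder-≡ (subst (λ p → SameOrder p D (letter a) d) ρa≡D (order a zero)))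
    ... | inj₂ ρa≡C = inj₂ (ρa≡C , sameOrder-≡
      (subst₂ (λ p q → SameOrder p q (letter a) c) ρa≡C (sym ρf≡C) (order a f)))

  around⇒contains : ∀ {d c} → SameOrder D C d c → Around r s d c (toList π) →
                    Contains π (surround r s D C)
  around⇒contains {r} {s} {d} {c} order ar
    with is , incr , letters ← sublist⇒matches (surround r s D C) π
           (around⇒match {R = LetterFor d c} (inj₁ (refl , refl)) (inj₂ (refl , refl)) ar) =
    is , incr , λ a b → ordered (letters a) (letters b)
    where
    ordered : ∀ {p q x y} → LetterFor d c p x → LetterFor d c q y → SameOrder p q x y
    ordered (inj₁ (refl , refl)) (inj₁ (refl , refl)) = sameOrder-refl _ _
    ordered (inj₁ (refl , refl)) (inj₂ (refl , refl)) = order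
    ordered (inj₂ (refl , refl)) (inj₁ (refl , refl)) = proj₂ order , proj₁ order
    ordered (inj₂ (refl , refl)) (inj₂ (refl , refl)) = sameOrder-refl _ _

-- "Above" and "below" tell on which side of the repeated letter d the single letter c lies: 112 and
-- 121 belong to the first kind, 2212 and 2122 to the second.
AvoidsAbove AvoidsBelow : ℕ → ℕ → List (Fin k) → Set
AvoidsAbove r s w = ∀ d c → d Fin.< c → ¬ Around r s d c w
AvoidsBelow r s w = ∀ d c → c Fin.< d → ¬ Around r s d c w

avoids-12 : ∀ r s (π : Word k n) → Avoids π (surround (suc r) s 1 2) ⇔ AvoidsAbove (suc r) s (toList π)
avoids-12 r s π = mk⇔
  (λ av d c d<c ar → av (around⇒contains (λ ()) π
    (mk⇔ (λ _ → s≤s (s≤s z≤n)) (λ _ → d<c) ,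
     mk⇔ (λ c<d → contradiction c<d (ℕ.<-asym d<c)) (λ { (s≤s ()) })) ar))
  (λ av con → case contains⇒around (λ ()) π con of λ
    (d , c , order , ar) → av d c (Equivalence.from (proj₁ order) (s≤s (s≤s z≤n))) ar)

avoids-21 : ∀ r s (π : Word k n) → Avoids π (surround (suc r) s 2 1) ⇔ AvoidsBelow (suc r) s (toList π)
avoids-21 r s π = mk⇔
  (λ av d c c<d ar → av (around⇒contains (λ ()) π
    (mk⇔ (λ d<c → contradiction d<c (ℕ.<-asym c<d)) (λ { (s≤s ()) }) ,
     mk⇔ (λ _ → s≤s (s≤s z≤n)) (λ _ → c<d)) ar))
  (λ av con → case contains⇒around (λ ()) π con of λ
    (d , c , order , ar) → av d c (Equivalence.from (proj₂ order) (s≤s (s≤s z≤n))) ar)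

-- Removal and insertion of the smallest letter

strip : List (Fin (suc k)) → List (Fin k)
strip []          = []
strip (zero ∷ w)  = strip w
strip (suc x ∷ w) = x ∷ strip w

strip-++ : (v w : List (Fin (suc k))) → strip (v ++ w) ≡ strip v ++ strip w
strip-++ []          w = refl
strip-++ (zero ∷ v)  w = strip-++ v w
strip-++ (suc x ∷ v) w = cong (x ∷_) (strip-++ v w)

strip-map-suc : (w : List (Fin k)) → strip (map suc w) ≡ w
strip-map-suc []      = refl
strip-map-suc (x ∷ w) = cong (x ∷_) (strip-map-suc w)

strip-replicate-zero : ∀ n → strip {k} (replicate n zero) ≡ []
strip-replicate-zero zero    = refl
strip-replicate-zero (suc n) = strip-replicate-zero n

occ-suc-strip : (i : Fin k) (w : List (Fin (suc k))) → occ (suc i) w ≡ occ i (strip w)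
occ-suc-strip i []          = refl
occ-suc-strip i (zero ∷ w)  = occ-suc-strip i w
occ-suc-strip i (suc x ∷ w) with does (i Fin.≟ x)
... | true  = cong suc (occ-suc-strip i w)
... | false = occ-suc-strip i w

occ-zero-map-suc : (w : List (Fin k)) → occ zero (map suc w) ≡ 0
occ-zero-map-suc []      = refl
occ-zero-map-suc (x ∷ w) = occ-zero-map-suc w

occ-zero≡0⇒map-suc : (w : List (Fin (suc k))) → occ zero w ≡ 0 → w ≡ map suc (strip w)
occ-zero≡0⇒map-suc []          _  = refl
occ-zero≡0⇒map-suc (suc x ∷ w) eq = cong (suc x ∷_) (occ-zero≡0⇒map-suc w eq)

around-strip : ∀ {d c : Fin k} w → Around r s (suc d) (suc c) w → Around r s d c (strip w)
around-strip {d = d} {c} w (around p q refl r≤ s≤) =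
  around (strip p) (strip q) (strip-++ p (suc c ∷ q))
    (subst (_ ≤_) (occ-suc-strip d p) r≤) (subst (_ ≤_) (occ-suc-strip d q) s≤)

strip-split : ∀ {c : Fin k} w p {q} → strip w ≡ p ++ c ∷ q →
              ∃₂ λ p′ q′ → w ≡ p′ ++ suc c ∷ q′ × strip p′ ≡ p × strip q′ ≡ q
strip-split []          []      ()
strip-split []          (y ∷ p) ()
strip-split (zero ∷ w)  p eq with p′ , q′ , refl , refl , refl ← strip-split w p eq =
  zero ∷ p′ , q′ , refl , refl , refl
strip-split (suc x ∷ w) []      refl = [] , w , refl , refl , refl
strip-split (suc x ∷ w) (y ∷ p) eq with refl , eq′ ← ∷-injective eq
  with p′ , q′ , refl , refl , refl ← strip-split w p eq′ = suc x ∷ p′ , q′ , refl , refl , refl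

around-unstrip : ∀ {d c : Fin k} w → Around r s d c (strip w) → Around r s (suc d) (suc c) w
around-unstrip {d = d} w (around p q eq r≤ s≤) with p′ , q′ , refl , refl , refl ← strip-split w p eq =
  around p′ q′ refl (subst (_ ≤_) (sym (occ-suc-strip d p′)) r≤) (subst (_ ≤_) (sym (occ-suc-strip d q′)) s≤)

-- A word avoiding 112 ends with all copies of its smallest letter but the
-- first; in a word avoiding 121 these follow the first copy immediately.
data Placement : Set where
  atEnd adjacent : Placement

-- The pattern 112 has 2 copies of the repeated letter before the larger one and 0 after it; 121 has
-- 1 and 1.
copiesBefore copiesAfter : Placement → ℕ
copiesBefore atEnd    = 2
copiesBefore adjacent = 1
copiesAfter  atEnd    = 0
copiesAfter  adjacent = 1

place : Placement → List A → List A → List A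
place atEnd    v z = v ++ z
place adjacent v z = z ++ v

place-[] : ∀ t (v : List A) → place t v [] ≡ v
place-[] atEnd    v = ++-identityʳ v
place-[] adjacent v = refl

place-hom : (f : List A → List B) → (∀ v w → f (v ++ w) ≡ f v ++ f w) →
            ∀ t v z → f (place t v z) ≡ place t (f v) (f z)
place-hom f f-++ atEnd    v z = f-++ v z
place-hom f f-++ adjacent v z = f-++ z v

place-+ : (f : List A → ℕ) → (∀ v w → f (v ++ w) ≡ f v + f w) →
          ∀ t v z → f (place t v z) ≡ f v + f z
place-+ f f-++ atEnd    v z = f-++ v z
place-+ f f-++ adjacent v z = trans (f-++ z v) (ℕ.+-comm (f z) (f v))

-- The first 0 marks the cut between u and v; n counts the zeros after it, so the multiplicity is n
-- + 1.
insertZeros : Placement → ℕ → List (Fin k) → List (Fin k) → List (Fin (suc k))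
insertZeros t n u v = map suc u ++ zero ∷ place t (map suc v) (replicate n zero)

strip-insertZeros : ∀ t n (u v : List (Fin k)) → strip (insertZeros t n u v) ≡ u ++ v
strip-insertZeros t n u v = begin
  strip (insertZeros t n u v)
    ≡⟨ strip-++ (map suc u) _ ⟩
  strip (map suc u) ++ strip (place t (map suc v) (replicate n zero))
    ≡⟨ cong₂ _++_ (strip-map-suc u) (place-hom strip strip-++ t (map suc v) _) ⟩
  u ++ place t (strip (map suc v)) (strip (replicate n zero))
    ≡⟨ cong (u ++_) (cong₂ (place t) (strip-map-suc v) (strip-replicate-zero n)) ⟩
  u ++ place t v []
    ≡⟨ cong (u ++_) (place-[] t v) ⟩
  u ++ v ∎
  where open ≡-Reasoning

length-insertZeros : ∀ t n (u v : List (Fin k)) → length (insertZeros t n u v) ≡ suc n + length (u ++ v)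
length-insertZeros t n u v = begin
  length (insertZeros t n u v)
    ≡⟨ length-++ (map suc u) ⟩
  length (map suc u) + suc (length (place t (map suc v) (replicate n zero)))
    ≡⟨ cong₂ (λ x y → x + suc y) (length-map suc u) (place-+ length (λ v _ → length-++ v) t (map suc v) _) ⟩
  length u + suc (length (map suc v) + length (replicate n zero))
    ≡⟨ cong₂ (λ x y → length u + suc (x + y)) (length-map suc v) (length-replicate n) ⟩
  length u + suc (length v + n)
    ≡⟨ ℕ.+-suc (length u) _ ⟩
  suc (length u + (length v + n))
    ≡⟨ cong suc (sym (ℕ.+-assoc (length u) (length v) n)) ⟩
  suc (length u + length v + n)
    ≡⟨ cong suc (ℕ.+-comm _ n) ⟩
  suc (n + (length u + length v))
    ≡⟨ cong (suc n +_) (sym (length-++ u)) ⟩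
  suc n + length (u ++ v) ∎
  where open ≡-Reasoning

-- A prefix without zeros either contains the letter c in question or can be discarded without
-- changing the number of zeros before c.
skip-map-suc : ∀ (u : List (Fin k)) {z c} p {q} → map suc u ++ z ≡ p ++ c ∷ q →
               occ zero p ≡ 0 ⊎ ∃ λ p′ → z ≡ p′ ++ c ∷ q × occ zero p ≡ occ zero p′
skip-map-suc []      p       eq = inj₂ (p , eq , refl)
skip-map-suc (x ∷ u) []      eq = inj₁ refl
skip-map-suc (x ∷ u) (y ∷ p) eq with refl , eq′ ← ∷-injective eq = skip-map-suc u p eq′

skip-zeros : ∀ n {c : Fin k} {z} p {q} → replicate n zero ++ z ≡ p ++ suc c ∷ q →
             ∃ λ p′ → z ≡ p′ ++ suc c ∷ q
skip-zeros zero    p       eq = p , eq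
skip-zeros (suc n) []      ()
skip-zeros (suc n) (y ∷ p) eq = skip-zeros n p (∷-injectiveʳ eq)

-- With `atEnd`, only the first 0 can precede a larger letter; with `adjacent`, all zeros are
-- consecutive, so no larger letter has zeros on both sides.
insertZeros-avoidsAbove-zero : ∀ t n (u v : List (Fin k)) c →
  ¬ Around (copiesBefore t) (copiesAfter t) zero (suc c) (insertZeros t n u v)
insertZeros-avoidsAbove-zero t n u v c (around p q eq r≤ s≤) with skip-map-suc u p eq
insertZeros-avoidsAbove-zero atEnd n u v c (around p q eq r≤ s≤) | inj₁ p≡0 =
  contradiction (subst (2 ≤_) p≡0 r≤) λ ()
insertZeros-avoidsAbove-zero adjacent n u v c (around p q eq r≤ s≤) | inj₁ p≡0 =
  contradiction (subst (1 ≤_) p≡0 r≤) λ ()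
insertZeros-avoidsAbove-zero t n u v c (around p q eq r≤ s≤) | inj₂ ([] , () , _)
insertZeros-avoidsAbove-zero atEnd n u v c (around p q eq r≤ s≤) | inj₂ (y ∷ p′ , eq′ , p≡)
  with refl , eq″ ← ∷-injective eq′ with skip-map-suc v p′ eq″
... | inj₁ p′≡0 = contradiction (subst (2 ≤_) (trans p≡ (cong suc p′≡0)) r≤) λ { (s≤s ()) }
-- Here `suc c` would have to be one of the trailing zeros.
... | inj₂ (p″ , eq‴ , _) with skip-zeros n p″ (trans (++-identityʳ _) eq‴)
...   | [] , ()
...   | _ ∷ _ , ()
insertZeros-avoidsAbove-zero adjacent n u v c (around p q eq r≤ s≤) | inj₂ (y ∷ p′ , eq′ , _)
  -- The letter `suc c` lies behind all zeros, so what follows it is part of `map suc v`.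
  with p″ , eq‴ ← skip-zeros n p′ (∷-injectiveʳ eq′) =
  contradiction (ℕ.≤-trans s≤ (ℕ.≤-trans (ℕ.m≤n+m _ (occ zero p″)) (ℕ.≤-reflexive none))) λ ()
  where
  none : occ zero p″ + occ zero q ≡ 0
  none = trans (sym (occ-++ zero p″ (suc c ∷ q))) (trans (cong (occ zero) (sym eq‴)) (occ-zero-map-suc v))

all-zeros : (w : List (Fin (suc k))) → (∀ c → ¬ Around 0 0 zero (suc c) w) → w ≡ replicate (occ zero w) zero
all-zeros []          none = refl
all-zeros (zero ∷ w)  none = cong (zero ∷_) (all-zeros w λ c → none c ∘ around-∷ zero)
all-zeros (suc x ∷ w) none = contradiction (around [] w refl z≤n z≤n) (none x)

-- Here w is what follows the first 0, so a single further 0 before a larger letter is already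
-- forbidden: from the next 0 on, only zeros remain.
zeros-atEnd : (w : List (Fin (suc k))) → (∀ c → ¬ Around 1 0 zero (suc c) w) →
              ∃ λ v → w ≡ map suc v ++ replicate (occ zero w) zero
zeros-atEnd []          none = [] , refl
zeros-atEnd (zero ∷ w)  none = [] , all-zeros (zero ∷ w) noSuc
  where
  noSuc : ∀ c → ¬ Around 0 0 zero (suc c) (zero ∷ w)
  noSuc c (around []      _ () _ _)
  noSuc c (around (y ∷ p) q eq _ _) =
    none c (around-suc (around p q (∷-injectiveʳ eq) z≤n z≤n))
zeros-atEnd (suc x ∷ w) none with v , eq ← zeros-atEnd w (λ c → none c ∘ around-∷ (suc x)) =
  x ∷ v , cong (suc x ∷_) eq

-- Again w follows the first 0, which is the copy required before the larger letter; once a larger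
-- letter appears, no 0 may come after it.
zeros-adjacent : (w : List (Fin (suc k))) → (∀ c → ¬ Around 0 1 zero (suc c) w) →
                 ∃ λ v → w ≡ replicate (occ zero w) zero ++ map suc v
zeros-adjacent []          none = [] , refl
zeros-adjacent (zero ∷ w)  none with v , eq ← zeros-adjacent w (λ c → none c ∘ around-∷ zero) =
  v , cong (zero ∷_) eq
zeros-adjacent (suc x ∷ w) none with occ zero w in eq
... | zero  = strip (suc x ∷ w) , cong (suc x ∷_) (occ-zero≡0⇒map-suc w eq)
... | suc m = contradiction (around [] w refl z≤n (subst (1 ≤_) (sym eq) (s≤s z≤n))) (none x)

-- The part before the first 0 becomes u; the places of the other zeros are then forced.
avoidsAbove-zero⇒insertZeros : ∀ t n (w : List (Fin (suc k))) → occ zero w ≡ suc n →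
  (∀ c → ¬ Around (copiesBefore t) (copiesAfter t) zero (suc c) w) →
  ∃₂ λ u v → w ≡ insertZeros t n u v
avoidsAbove-zero⇒insertZeros t n (suc x ∷ w) eq none
  with u , v , refl ← avoidsAbove-zero⇒insertZeros t n w eq (λ c → none c ∘ around-∷ (suc x)) =
  x ∷ u , v , refl
avoidsAbove-zero⇒insertZeros atEnd n (zero ∷ w) refl none
  with v , eq ← zeros-atEnd w (λ c → none c ∘ around-suc) = [] , v , cong (zero ∷_) eq
avoidsAbove-zero⇒insertZeros adjacent n (zero ∷ w) refl none
  with v , eq ← zeros-adjacent w (λ c → none c ∘ around-suc) = [] , v , cong (zero ∷_) eq

-- The word u is recovered as the part before the first 0.
insertZeros-injective : ∀ t n (u u′ v v′ : List (Fin k)) →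
  insertZeros t n u v ≡ insertZeros t n u′ v′ → u ≡ u′
insertZeros-injective t n []      []       v v′ eq = refl
insertZeros-injective t n (x ∷ u) (y ∷ u′) v v′ eq with refl , eq′ ← ∷-injective eq =
  cong (x ∷_) (insertZeros-injective t n u u′ v v′ eq′)

-- Words as sequences of blocks

-- (i , m) stands for a run of m + 1 copies of i.
Block : ℕ → Set
Block k = Fin k × ℕ

-- Neighbouring blocks of the same letter stay separate, so a sequence of blocks carries more than
-- its word: it records where a smaller letter may be inserted.
expand : List (Block k) → List (Fin k)
expand = concatMap λ (i , m) → replicate (suc m) i

expand-++ : (bs cs : List (Block k)) → expand (bs ++ cs) ≡ expand bs ++ expand cs
expand-++ = concatMap-++ _

runs : Fin k → List (Block k) → List ℕ
runs i bs = map proj₂ (filter ((i Fin.≟_) ∘ proj₁) bs)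

runs-++ : (i : Fin k) → ∀ bs cs → runs i (bs ++ cs) ≡ runs i bs ++ runs i cs
runs-++ i bs cs = trans (cong (map proj₂) (filter-++ _ bs cs)) (map-++ proj₂ (filter _ bs) _)

runs-here : (i : Fin k) → ∀ m bs → runs i ((i , m) ∷ bs) ≡ m ∷ runs i bs
runs-here i m bs = cong (map proj₂) (filter-accept ((i Fin.≟_) ∘ proj₁) {xs = bs} refl)

total : List ℕ → ℕ
total = sum ∘ map suc

occ-expand : (i : Fin k) → ∀ bs → occ i (expand bs) ≡ total (runs i bs)
occ-expand i []             = refl
occ-expand i ((j , m) ∷ bs) = trans (occ-++ i (replicate (suc m) j) (expand bs)) step
  where
  step : occ i (replicate (suc m) j) + occ i (expand bs) ≡ total (runs i ((j , m) ∷ bs))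
  step with i Fin.≟ j
  ... | yes refl = cong₂ (λ x y → suc x + y) (occ-replicate-here i m) (occ-expand i bs)
  ... | no  i≢j  = cong₂ _+_ (occ-replicate-there i≢j m) (occ-expand i bs)

further : ℕ → List ℕ
further zero    = []
further (suc m) = m ∷ []

total-further : ∀ n → total (further n) ≡ n
total-further zero    = refl
total-further (suc m) = cong suc (ℕ.+-identityʳ m)

-- The occurrences of i form a block of length 1 followed, when there are
-- others, by one block comprising these.
TwoRuns : Vec ℕ k → List (Block k) → Set
TwoRuns b bs = ∀ i → runs i bs ≡ 0 ∷ further (lookup b i)

module _ (b : Vec ℕ k) where

  twoRuns⇒occ : ∀ bs → TwoRuns b bs → ∀ i → occ i (expand bs) ≡ suc (lookup b i)
  twoRuns⇒occ bs two i = begin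
    occ i (expand bs)                      ≡⟨ occ-expand i bs ⟩
    total (runs i bs)                      ≡⟨ cong total (two i) ⟩
    suc (total (further (lookup b i)))     ≡⟨ cong suc (total-further (lookup b i)) ⟩
    suc (lookup b i)                       ∎
    where open ≡-Reasoning

  -- The first block of i has length 1, so two copies before a boundary of blocks include the whole
  -- second block, and none is left behind the boundary.
  twoRuns-separate : ∀ xs ys → TwoRuns b (xs ++ ys) → ∀ i →
                     2 ≤ occ i (expand xs) → 1 ≤ occ i (expand ys) → ⊥
  twoRuns-separate xs ys two i 2≤ 1≤ =
    separate (lookup b i) (runs i xs) (runs i ys) (trans (sym (runs-++ i xs ys)) (two i))
      (subst (2 ≤_) (occ-expand i xs) 2≤) (subst (1 ≤_) (occ-expand i ys) 1≤)
    where
    separate : ∀ n ms ns → ms ++ ns ≡ 0 ∷ further n → 2 ≤ total ms → 1 ≤ total ns → ⊥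
    separate n       []             ns       eq   ()       1≤
    separate n       (zero ∷ [])    ns       eq   (s≤s ()) 1≤
    separate (suc n) (_ ∷ _ ∷ [])   []       refl 2≤       ()
    separate (suc n) (_ ∷ _ ∷ [])   (_ ∷ _)  ()   2≤       1≤
    separate (suc n) (_ ∷ _ ∷ _ ∷ _) ns      ()   2≤       1≤

  -- A block of length at least 2 cannot be the first block of its letter.
  twoRuns-long : ∀ xs i m ys → TwoRuns b (xs ++ (i , suc m) ∷ ys) → 1 ≤ occ i (expand xs)
  twoRuns-long xs i m ys two = subst (1 ≤_) (sym (occ-expand i xs))
    (nonempty (runs i xs)
      (trans (sym (trans (runs-++ i xs _) (cong (runs i xs ++_) (runs-here i (suc m) ys)))) (two i)))
    where
    nonempty : ∀ ms {ns n} → ms ++ suc m ∷ ns ≡ 0 ∷ further n → 1 ≤ total ms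
    nonempty []       ()
    nonempty (_ ∷ ms) _ = s≤s z≤n

-- Cuts of a word relative to its blocks

data Cut (bs : List (Block k)) : List (Fin k) → List (Fin k) → Set where
  between : ∀ xs ys → bs ≡ xs ++ ys → Cut bs (expand xs) (expand ys)
  -- The block has length r + s + 2, and r + 1 and s + 1 of its copies fall on the two sides, so
  -- neither part of it is empty.
  within  : ∀ xs i r s ys → bs ≡ xs ++ (i , suc (r + s)) ∷ ys →
            Cut bs (expand xs ++ replicate (suc r) i) (replicate (suc s) i ++ expand ys)

cut-replicate : ∀ m (i : A) {e} p {q} → replicate m i ++ e ≡ p ++ q →
  (∃ λ z → p ≡ replicate m i ++ z × e ≡ z ++ q) ⊎
  (∃₂ λ r s → m ≡ r + suc s × p ≡ replicate r i × q ≡ replicate (suc s) i ++ e)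
cut-replicate zero    i p       eq = inj₁ (p , refl , eq)
cut-replicate (suc m) i []      eq = inj₂ (0 , m , refl , refl , sym eq)
cut-replicate (suc m) i (x ∷ p) eq with refl , eq′ ← ∷-injective eq with cut-replicate m i p eq′
... | inj₁ (z , refl , e≡)            = inj₁ (z , refl , e≡)
... | inj₂ (r , s , refl , refl , q≡) = inj₂ (suc r , s , refl , refl , q≡)

cut : ∀ (bs : List (Block k)) p {q} → expand bs ≡ p ++ q → Cut bs p q
cut []             []      refl = between [] [] refl
cut ((i , m) ∷ bs) p       eq   with cut-replicate (suc m) i p eq
-- No copy precedes the cut, which is therefore a boundary of blocks.
... | inj₂ (zero , s , refl , refl , refl)  = between [] ((i , m) ∷ bs) refl
... | inj₂ (suc r , s , m≡ , refl , refl) =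
  within [] i r s bs (cong (λ m → (i , m) ∷ bs) (trans (ℕ.suc-injective m≡) (ℕ.+-suc r s)))
... | inj₁ (z , refl , e≡) with cut bs z e≡
...   | between xs ys refl       = between ((i , m) ∷ xs) ys refl
...   | within xs j r s ys refl  =
  subst (λ p → Cut ((i , m) ∷ bs) p (replicate (suc s) j ++ expand ys)) (++-assoc (replicate (suc m) i) (expand xs) _)
    (within ((i , m) ∷ xs) j r s ys refl)

-- The word is cut just before c. At a boundary of blocks, copies of d cannot be distributed as 2212
-- requires. Inside a block, that block consists of copies of c, which differs from d, so the cut
-- may be moved to the start of the block.
twoRuns⇒avoidsBelow : ∀ (b : Vec ℕ k) bs → TwoRuns b bs → AvoidsBelow 2 1 (expand bs)
twoRuns⇒avoidsBelow b bs two d c c<d (around p q eq 2≤ 1≤) = go (cut bs p eq) refl 2≤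
  where
  d≢c : d ≢ c
  d≢c d≡c = ℕ.<-irrefl (cong toℕ (sym d≡c)) c<d

  go : ∀ {p q′} → Cut bs p q′ → q′ ≡ c ∷ q → 2 ≤ occ d p → ⊥
  go (between xs ys refl) q≡ 2≤ =
    twoRuns-separate b xs ys two d 2≤ (subst (λ w → 1 ≤ occ d w) (sym q≡) (ℕ.≤-trans 1≤ (occ-∷ d c q)))
  go (within xs i r s ys refl) q≡ 2≤ with refl , refl ← ∷-injective q≡ =
    twoRuns-separate b xs ((i , suc (r + s)) ∷ ys) two d
      (subst (2 ≤_) (trans (occ-++ d (expand xs) _)
        (trans (cong (occ d (expand xs) +_) (occ-replicate-there d≢c (suc r))) (ℕ.+-identityʳ _))) 2≤)
      (ℕ.≤-trans 1≤ (ℕ.≤-trans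
        (ℕ.≤-reflexive (trans (occ-++ d (replicate s i) _) (cong (_+ occ d (expand ys)) (occ-replicate-there d≢c s))))
        (ℕ.≤-trans (ℕ.m≤n+m _ (occ d (replicate (suc (suc (r + s))) i)))
          (ℕ.≤-reflexive (sym (occ-++ d (replicate (suc (suc (r + s))) i) (expand ys)))))))

-- Insertion of a smaller letter between u and v creates 2212 unless u and v
-- meet at a boundary of blocks.
avoidsBelow⇒boundary : ∀ (b : Vec ℕ k) {bs} → TwoRuns b bs → ∀ t n u v → expand bs ≡ u ++ v →
  AvoidsBelow 2 1 (insertZeros t n u v) → ∃₂ λ xs ys → bs ≡ xs ++ ys × u ≡ expand xs × v ≡ expand ys
avoidsBelow⇒boundary b {bs} two t n u v eq avoid with cut bs u eq
... | between xs ys bs≡         = xs , ys , bs≡ , refl , refl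
... | within xs i r s ys refl = contradiction
  -- The letter `suc i` completes 2212 around the inserted 0: an earlier block and the left part of
  -- the cut block give two copies before it, the right part gives one after it.
  (around (map suc u) _ refl two≤ (subst (1 ≤_) (sym afterwards) (s≤s z≤n)))
  (avoid (suc i) zero (s≤s z≤n))
  where
  u′ = expand xs ++ replicate (suc r) i
  v′ = replicate (suc s) i ++ expand ys
  open ≡-Reasoning

  occ-map-suc : ∀ w → occ (suc i) (map suc w) ≡ occ i w
  occ-map-suc w = trans (occ-suc-strip i (map suc w)) (cong (occ i) (strip-map-suc w))

  two≤ : 2 ≤ occ (suc i) (map suc u′)
  two≤ = ℕ.≤-trans (ℕ.+-mono-≤ (twoRuns-long b xs i (r + s) ys two)
                                (ℕ.≤-trans (s≤s z≤n) (ℕ.≤-reflexive (sym (occ-replicate-here i (suc r))))))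
                   (ℕ.≤-reflexive (sym (trans (occ-map-suc u′) (occ-++ i (expand xs) _))))

  afterwards : occ (suc i) (place t (map suc v′) (replicate n zero)) ≡
               suc (occ i (replicate s i ++ expand ys))
  afterwards = begin
    occ (suc i) (place t (map suc v′) (replicate n zero))
      ≡⟨ place-+ (occ (suc i)) (occ-++ (suc i)) t (map suc v′) _ ⟩
    occ (suc i) (map suc v′) + occ (suc i) (replicate n zero)
      ≡⟨ cong₂ _+_ (occ-map-suc v′) (occ-replicate-there (λ ()) n) ⟩
    occ i v′ + 0
      ≡⟨ ℕ.+-identityʳ _ ⟩
    occ i v′
      ≡⟨ occ-here i _ ⟩
    suc (occ i (replicate s i ++ expand ys)) ∎

-- Insertion of the smallest letter into a sequence of blocks

lift : Block k → Block (suc k)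
lift (i , m) = suc i , m

-- The first 0 and the remaining zeros form separate blocks even when they are adjacent, since a
-- smaller letter may later be inserted between them.
insertBlocks : Placement → ℕ → List (Block k) → List (Block k) → List (Block (suc k))
insertBlocks t n u v = map lift u ++ (zero , 0) ∷ place t (map lift v) (map (zero ,_) (further n))

expand-map-lift : (bs : List (Block k)) → expand (map lift bs) ≡ map suc (expand bs)
expand-map-lift []             = refl
expand-map-lift ((i , m) ∷ bs) = begin
  replicate (suc m) (suc i) ++ expand (map lift bs)
    ≡⟨ cong₂ _++_ (sym (map-replicate suc (suc m) i)) (expand-map-lift bs) ⟩
  map suc (replicate (suc m) i) ++ map suc (expand bs)
    ≡⟨ sym (map-++ suc (replicate (suc m) i) (expand bs)) ⟩
  map suc (replicate (suc m) i ++ expand bs) ∎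
  where open ≡-Reasoning

expand-further : ∀ n → expand {suc k} (map (zero ,_) (further n)) ≡ replicate n zero
expand-further zero    = refl
expand-further (suc m) = ++-identityʳ _

expand-insertBlocks : ∀ t n (u v : List (Block k)) →
  expand (insertBlocks t n u v) ≡ insertZeros t n (expand u) (expand v)
expand-insertBlocks t n u v = begin
  expand (insertBlocks t n u v)
    ≡⟨ expand-++ (map lift u) _ ⟩
  expand (map lift u) ++ zero ∷ expand (place t (map lift v) (map (zero ,_) (further n)))
    ≡⟨ cong₂ (λ x y → x ++ zero ∷ y) (expand-map-lift u) (place-hom expand expand-++ t (map lift v) _) ⟩
  map suc (expand u) ++ zero ∷ place t (expand (map lift v)) (expand (map (zero ,_) (further n)))
    ≡⟨ cong₂ (λ x y → map suc (expand u) ++ zero ∷ place t x y) (expand-map-lift v) (expand-further n) ⟩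
  insertZeros t n (expand u) (expand v) ∎
  where open ≡-Reasoning

runs-zero-map-lift : (bs : List (Block k)) → runs zero (map lift bs) ≡ []
runs-zero-map-lift []       = refl
runs-zero-map-lift (_ ∷ bs) = runs-zero-map-lift bs

runs-suc-map-lift : (i : Fin k) → ∀ bs → runs (suc i) (map lift bs) ≡ runs i bs
runs-suc-map-lift i []             = refl
runs-suc-map-lift i ((j , m) ∷ bs) with does (i Fin.≟ j)
... | true  = cong (m ∷_) (runs-suc-map-lift i bs)
... | false = runs-suc-map-lift i bs

runs-zero-map-zero : ∀ ms → runs {suc k} zero (map (zero ,_) ms) ≡ ms
runs-zero-map-zero []       = refl
runs-zero-map-zero (m ∷ ms) = cong (m ∷_) (runs-zero-map-zero ms)

runs-suc-map-zero : (i : Fin k) → ∀ ms → runs (suc i) (map (zero ,_) ms) ≡ []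
runs-suc-map-zero i []       = refl
runs-suc-map-zero i (m ∷ ms) = runs-suc-map-zero i ms

place-[]ˡ : ∀ t (z : List A) → place t [] z ≡ z
place-[]ˡ atEnd    z = refl
place-[]ˡ adjacent z = ++-identityʳ z

twoRuns-insertBlocks : ∀ t n (b : Vec ℕ k) u v → TwoRuns b (u ++ v) → TwoRuns (n ∷ b) (insertBlocks t n u v)
twoRuns-insertBlocks t n b u v two zero = begin
  runs zero (insertBlocks t n u v)
    ≡⟨ runs-++ zero (map lift u) _ ⟩
  runs zero (map lift u) ++ 0 ∷ runs zero (place t (map lift v) (map (zero ,_) (further n)))
    ≡⟨ cong₂ (λ x y → x ++ 0 ∷ y) (runs-zero-map-lift u)
         (place-hom (runs zero) (runs-++ zero) t (map lift v) _) ⟩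
  0 ∷ place t (runs zero (map lift v)) (runs zero (map (zero ,_) (further n)))
    ≡⟨ cong₂ (λ x y → 0 ∷ place t x y) (runs-zero-map-lift v) (runs-zero-map-zero (further n)) ⟩
  0 ∷ place t [] (further n)
    ≡⟨ cong (0 ∷_) (place-[]ˡ t (further n)) ⟩
  0 ∷ further n ∎
  where open ≡-Reasoning
twoRuns-insertBlocks t n b u v two (suc i) = begin
  runs (suc i) (insertBlocks t n u v)
    ≡⟨ runs-++ (suc i) (map lift u) _ ⟩
  runs (suc i) (map lift u) ++ runs (suc i) (place t (map lift v) (map (zero ,_) (further n)))
    ≡⟨ cong₂ _++_ (runs-suc-map-lift i u)
         (place-hom (runs (suc i)) (runs-++ (suc i)) t (map lift v) _) ⟩
  runs i u ++ place t (runs (suc i) (map lift v)) (runs (suc i) (map (zero ,_) (further n)))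
    ≡⟨ cong₂ (λ x y → runs i u ++ place t x y) (runs-suc-map-lift i v) (runs-suc-map-zero i (further n)) ⟩
  runs i u ++ place t (runs i v) []
    ≡⟨ cong (runs i u ++_) (place-[] t (runs i v)) ⟩
  runs i u ++ runs i v
    ≡⟨ sym (runs-++ i u v) ⟩
  runs i (u ++ v)
    ≡⟨ two i ⟩
  0 ∷ further (lookup b i) ∎
  where open ≡-Reasoning

-- The increase does not depend on the placement, so both classes offer equally many cuts at every
-- stage.
length-insertBlocks : ∀ t n (u v : List (Block k)) →
  length (insertBlocks t n u v) ≡ suc (length (further n)) + length (u ++ v)
length-insertBlocks t n u v = begin
  length (insertBlocks t n u v)
    ≡⟨ length-++ (map lift u) ⟩
  length (map lift u) + suc (length (place t (map lift v) (map (zero ,_) (further n))))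
    ≡⟨ cong₂ (λ x y → x + suc y) (length-map lift u) (place-+ length (λ v _ → length-++ v) t (map lift v) _) ⟩
  length u + suc (length (map lift v) + length (map {B = Block _} (zero ,_) (further n)))
    ≡⟨ cong₂ (λ x y → length u + suc (x + y)) (length-map lift v) (length-map (zero ,_) (further n)) ⟩
  length u + suc (length v + length (further n))
    ≡⟨ ℕ.+-suc (length u) _ ⟩
  suc (length u + (length v + length (further n)))
    ≡⟨ cong suc (sym (ℕ.+-assoc (length u) (length v) _)) ⟩
  suc (length u + length v + length (further n))
    ≡⟨ cong suc (ℕ.+-comm _ (length (further n))) ⟩
  suc (length (further n) + (length u + length v))
    ≡⟨ cong (suc (length (further n)) +_) (sym (length-++ u)) ⟩
  suc (length (further n)) + length (u ++ v) ∎
  where open ≡-Reasoning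

-- Encoding of admissible words

blockCount : Vec ℕ k → ℕ
blockCount []      = 0
blockCount (n ∷ b) = suc (length (further n)) + blockCount b

-- For each letter, the code holds the number of blocks of larger letters that precede its first
-- copy: m blocks have m + 1 boundaries, counting both ends. An entry n of the vector stands for
-- multiplicity n + 1.
Code : Vec ℕ k → Set
Code []      = ⊤
Code (n ∷ b) = Fin (suc (blockCount b)) × Code b

allCodes : (b : Vec ℕ k) → List (Code b)
allCodes []      = tt ∷ []
allCodes (n ∷ b) = cartesianProduct (allFin _) (allCodes b)

∈-allCodes : (b : Vec ℕ k) (c : Code b) → c ∈ allCodes b
∈-allCodes []      tt      = here refl
∈-allCodes (n ∷ b) (j , c) = ∈-cartesianProduct⁺ (∈-allFin j) (∈-allCodes b c)

allCodes-unique : (b : Vec ℕ k) → Unique (allCodes b)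
allCodes-unique []      = [] ∷ []
allCodes-unique (n ∷ b) = Unique.cartesianProduct⁺ (Unique.allFin⁺ _) (allCodes-unique b)

module _ (t : Placement) where

  decode : (b : Vec ℕ k) → Code b → List (Block k)
  decode []      tt      = []
  decode (n ∷ b) (j , c) = insertBlocks t n (take (toℕ j) (decode b c)) (drop (toℕ j) (decode b c))

  decodeWord : (b : Vec ℕ k) → Code b → List (Fin k)
  decodeWord b c = expand (decode b c)

  length-decode : (b : Vec ℕ k) (c : Code b) → length (decode b c) ≡ blockCount b
  length-decode []      tt      = refl
  length-decode (n ∷ b) (j , c) = trans (length-insertBlocks t n (take (toℕ j) (decode b c)) _)
    (cong (suc (length (further n)) +_)
      (trans (cong length (take++drop≡id (toℕ j) (decode b c))) (length-decode b c)))

  decode-twoRuns : (b : Vec ℕ k) (c : Code b) → TwoRuns b (decode b c)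
  decode-twoRuns (n ∷ b) (j , c) = twoRuns-insertBlocks t n b (take (toℕ j) (decode b c)) _
    (subst (TwoRuns b) (sym (take++drop≡id (toℕ j) (decode b c))) (decode-twoRuns b c))

  decodeWord-∷ : ∀ n (b : Vec ℕ k) j c → decodeWord (n ∷ b) (j , c) ≡
    insertZeros t n (expand (take (toℕ j) (decode b c))) (expand (drop (toℕ j) (decode b c)))
  decodeWord-∷ n b j c = expand-insertBlocks t n (take (toℕ j) (decode b c)) _

  expand-take-drop : ∀ j (bs : List (Block k)) → expand (take j bs) ++ expand (drop j bs) ≡ expand bs
  expand-take-drop j bs = trans (sym (expand-++ (take j bs) _)) (cong expand (take++drop≡id j bs))

  strip-decodeWord : ∀ n (b : Vec ℕ k) j c → strip (decodeWord (n ∷ b) (j , c)) ≡ decodeWord b c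
  strip-decodeWord n b j c = begin
    strip (decodeWord (n ∷ b) (j , c))
      ≡⟨ cong strip (decodeWord-∷ n b j c) ⟩
    strip (insertZeros t n (expand (take (toℕ j) (decode b c))) _)
      ≡⟨ strip-insertZeros t n (expand (take (toℕ j) (decode b c))) _ ⟩
    expand (take (toℕ j) (decode b c)) ++ expand (drop (toℕ j) (decode b c))
      ≡⟨ expand-take-drop (toℕ j) (decode b c) ⟩
    decodeWord b c ∎
    where open ≡-Reasoning

  length-decodeWord : (b : Vec ℕ k) (c : Code b) → length (decodeWord b c) ≡ Vec.sum (Vec.map suc b)
  length-decodeWord []      tt      = refl
  length-decodeWord (n ∷ b) (j , c) = begin
    length (decodeWord (n ∷ b) (j , c))
      ≡⟨ cong length (decodeWord-∷ n b j c) ⟩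
    length (insertZeros t n (expand (take (toℕ j) (decode b c))) _)
      ≡⟨ length-insertZeros t n (expand (take (toℕ j) (decode b c))) _ ⟩
    suc n + length (expand (take (toℕ j) (decode b c)) ++ expand (drop (toℕ j) (decode b c)))
      ≡⟨ cong (λ w → suc n + length w) (expand-take-drop (toℕ j) (decode b c)) ⟩
    suc n + length (decodeWord b c)
      ≡⟨ cong (suc n +_) (length-decodeWord b c) ⟩
    suc n + Vec.sum (Vec.map suc b) ∎
    where open ≡-Reasoning

  -- For `atEnd` the forbidden patterns are 112 and 2212, for `adjacent` they are 121 and 2212; the
  -- latter class is that of {121, 2122} after reversal.
  record Admissible (b : Vec ℕ k) (w : List (Fin k)) : Set where
    field
      multiplicity : ∀ i → occ i w ≡ suc (lookup b i)
      avoidsAbove  : AvoidsAbove (copiesBefore t) (copiesAfter t) w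
      avoidsBelow  : AvoidsBelow 2 1 w

  open Admissible

  -- If the repeated letter is 0, the shape of the insertion decides; otherwise both letters survive
  -- the deletion of zeros and induction applies.
  decodeWord-avoidsAbove : (b : Vec ℕ k) (c : Code b) →
    AvoidsAbove (copiesBefore t) (copiesAfter t) (decodeWord b c)
  decodeWord-avoidsAbove (n ∷ b) (j , c) zero (suc x) _ ar =
    insertZeros-avoidsAbove-zero t n (expand (take (toℕ j) (decode b c))) _ x
      (subst (Around _ _ zero (suc x)) (decodeWord-∷ n b j c) ar)
  decodeWord-avoidsAbove (n ∷ b) (j , c) (suc d) (suc x) (s≤s d<x) ar =
    decodeWord-avoidsAbove b c d x d<x
      (subst (Around _ _ d x) (strip-decodeWord n b j c) (around-strip _ ar))

  decodeWord-admissible : (b : Vec ℕ k) (c : Code b) → Admissible b (decodeWord b c)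
  decodeWord-admissible b c = record
    { multiplicity = twoRuns⇒occ b (decode b c) (decode-twoRuns b c)
    ; avoidsAbove  = decodeWord-avoidsAbove b c
    ; avoidsBelow  = twoRuns⇒avoidsBelow b (decode b c) (decode-twoRuns b c)
    }

  admissible-strip : ∀ {n} {b : Vec ℕ k} {w} → Admissible (n ∷ b) w → Admissible b (strip w)
  admissible-strip {w = w} adm = record
    { multiplicity = λ i → trans (sym (occ-suc-strip i w)) (multiplicity adm (suc i))
    ; avoidsAbove  = λ d c d<c ar → avoidsAbove adm (suc d) (suc c) (s≤s d<c) (around-unstrip w ar)
    ; avoidsBelow  = λ d c c<d ar → avoidsBelow adm (suc d) (suc c) (s≤s c<d) (around-unstrip w ar)
    }

  -- Avoidance above 0 forces the shape of the word, induction decodes what remains without zeros,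
  -- and avoidance of 2212 puts the cut at a boundary of blocks. The number of blocks before the cut
  -- is the new component of the code.
  decodeWord-surjective : (b : Vec ℕ k) → ∀ w → Admissible b w → ∃ λ c → decodeWord b c ≡ w
  decodeWord-surjective []      []      adm = tt , refl
  decodeWord-surjective []      (() ∷ _)
  decodeWord-surjective (n ∷ b) w       adm
    with u , v , refl ← avoidsAbove-zero⇒insertZeros t n w (multiplicity adm zero)
                          (λ c → avoidsAbove adm zero (suc c) (s≤s z≤n))
    with c , eq ← decodeWord-surjective b (strip w) (admissible-strip adm)
    with xs , ys , bs≡ , refl , refl ← avoidsBelow⇒boundary b (decode-twoRuns b c) t n u v
                          (trans eq (strip-insertZeros t n u v)) (avoidsBelow adm) =
    (j , c) , trans (decodeWord-∷ n b j c)
                    (cong₂ (insertZeros t n) (cong expand take≡) (cong expand drop≡))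
    where
    xs≤ : length xs < suc (blockCount b)
    xs≤ = s≤s (ℕ.≤-trans (ℕ.m≤m+n (length xs) (length ys))
      (ℕ.≤-reflexive (trans (sym (trans (cong length bs≡) (length-++ xs))) (length-decode b c))))

    j = Fin.fromℕ< xs≤

    take-length : ∀ (xs : List A) {ys} → take (length xs) (xs ++ ys) ≡ xs
    take-length []       = refl
    take-length (x ∷ xs) = cong (x ∷_) (take-length xs)

    take≡ : take (toℕ j) (decode b c) ≡ xs
    take≡ = trans (cong₂ take (Fin.toℕ-fromℕ< xs≤) bs≡) (take-length xs)

    drop≡ : drop (toℕ j) (decode b c) ≡ ys
    drop≡ = ++-cancelˡ xs _ _
      (trans (cong (_++ drop (toℕ j) (decode b c)) (sym take≡)) (trans (take++drop≡id (toℕ j) (decode b c)) bs≡))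

  -- Blocks are nonempty, so a further block always lengthens the word; the bounds exclude the range
  -- in which `take` is constant.
  expand-take-injective : ∀ (bs : List (Block k)) i j → i ≤ length bs → j ≤ length bs →
    expand (take i bs) ≡ expand (take j bs) → i ≡ j
  expand-take-injective bs             zero    zero    _        _        _  = refl
  expand-take-injective ((x , m) ∷ bs) zero    (suc j) _        _        ()
  expand-take-injective ((x , m) ∷ bs) (suc i) zero    _        _        ()
  expand-take-injective ((x , m) ∷ bs) (suc i) (suc j) (s≤s i≤) (s≤s j≤) eq =
    cong suc (expand-take-injective bs i j i≤ j≤ (++-cancelˡ (replicate (suc m) x) _ _ eq))

  -- Deleting the zeros recovers the word of the smaller code, and the part before the first 0
  -- recovers the cut.
  decodeWord-injective : (b : Vec ℕ k) → ∀ {c c′} → decodeWord b c ≡ decodeWord b c′ → c ≡ c′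
  decodeWord-injective []                              eq = refl
  decodeWord-injective (n ∷ b) {j , c} {j′ , c′} eq
    with refl ← decodeWord-injective b {c} {c′}
      (trans (sym (strip-decodeWord n b j c)) (trans (cong strip eq) (strip-decodeWord n b j′ c′))) =
    cong (_, c) (Fin.toℕ-injective (expand-take-injective (decode b c) (toℕ j) (toℕ j′) (inside j) (inside j′)
      (insertZeros-injective t n _ _ _ _
        (trans (sym (decodeWord-∷ n b j c)) (trans eq (decodeWord-∷ n b j′ c))))))
    where
    inside : (j : Fin (suc (blockCount b))) → toℕ j ≤ length (decode b c)
    inside j = subst (toℕ j ≤_) (sym (length-decode b c)) (ℕ.≤-pred (Fin.toℕ<n j))

-- Counting words by codes

toList-injective : {π σ : Vec A n} → toList π ≡ toList σ → π ≡ σ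
toList-injective {π = π} {σ} eq = trans (sym (Vec.cast-is-id refl π)) (Vec.toList-injective refl π σ eq)

toList-surjective : (w : List A) → length w ≡ n → ∃ λ (π : Vec A n) → toList π ≡ w
toList-surjective w refl = fromList w , Vec.toList∘fromList w

module _ {C : Set} {cs : List C} (cs-unique : Unique cs) (∈-cs : ∀ c → c ∈ cs)
         {f : C → List (Fin k)} (f-injective : ∀ {c c′} → f c ≡ f c′ → c ≡ c′)
         {P : Word k n → Set} (P? : Decidable P) where

  -- Two duplicate-free lists with the same members are permutations of each other; vectors are
  -- first turned into lists, where the values of f live.
  count-words : (∀ c → ∃ λ π → toList π ≡ f c × P π) → (∀ π → P π → ∃ λ c → f c ≡ toList π) →
                length (filter P? (allWords k n)) ≡ length cs
  count-words sound complete = begin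
    length (filter P? (allWords k n))               ≡⟨ sym (length-map toList (filter P? (allWords k n))) ⟩
    length (map toList (filter P? (allWords k n)))  ≡⟨ ↭-length (∼bag⇒↭ (unique∧set⇒bag uniqueˡ uniqueʳ (mk⇔ to from))) ⟩
    length (map f cs)                               ≡⟨ length-map f cs ⟩
    length cs                                       ∎
    where
    open ≡-Reasoning
    uniqueˡ = Unique.map⁺ toList-injective (Unique.filter⁺ P? (allWords-unique k n))
    uniqueʳ = Unique.map⁺ f-injective cs-unique

    to : ∀ {w} → w ∈ map toList (filter P? (allWords k n)) → w ∈ map f cs
    to w∈ with π , π∈ , refl ← ∈-map⁻ toList w∈
      with c , eq ← complete π (proj₂ (∈-filter⁻ P? {xs = allWords k n} π∈)) =
      subst (_∈ map f cs) eq (∈-map⁺ f (∈-cs c))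

    from : ∀ {w} → w ∈ map f cs → w ∈ map toList (filter P? (allWords k n))
    from w∈ with c , _ , refl ← ∈-map⁻ f w∈ with π , eq , Pπ ← sound c =
      subst (_∈ map toList (filter P? (allWords k n))) eq (∈-map⁺ toList (∈-filter⁺ P? (∈-allWords π) Pπ))

module _ (b : Vec ℕ k) (n≡ : n ≡ Vec.sum (Vec.map suc b)) (t : Placement) (g : List (Fin k) → List (Fin k))
         (g-involutive : ∀ w → g (g w) ≡ w) (length-g : ∀ w → length (g w) ≡ length w) where

  -- The involution g covers both classes at once: it is the identity for {112, 2212} and reversal
  -- for {121, 2122}.
  count-admissible : {P : Word k n → Set} (P? : Decidable P) → (∀ π → P π ⇔ Admissible t b (g (toList π))) →
                     length (filter P? (allWords k n)) ≡ length (allCodes b)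
  count-admissible {P} P? P⇔ = count-words (allCodes-unique b) (∈-allCodes b)
    (λ {c} {c′} eq → decodeWord-injective t b
      (trans (sym (g-involutive _)) (trans (cong g eq) (g-involutive _)))) P? sound complete
    where
    sound : ∀ c → ∃ λ π → toList π ≡ g (decodeWord t b c) × P π
    sound c with π , eq ← toList-surjective (g (decodeWord t b c))
                            (trans (length-g _) (trans (length-decodeWord t b c) (sym n≡))) =
      π , eq , Equivalence.from (P⇔ π)
        (subst (Admissible t b) (sym (trans (cong g eq) (g-involutive _))) (decodeWord-admissible t b c))

    complete : ∀ π → P π → ∃ λ c → g (decodeWord t b c) ≡ toList π
    complete π Pπ with c , eq ← decodeWord-surjective t b _ (Equivalence.to (P⇔ π) Pπ) =
      c , trans (cong g eq) (g-involutive _)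

-- The two sets of patterns

around-unreverse : ∀ {d c : Fin k} w → Around r s d c (reverse w) → Around s r d c w
around-unreverse w ar = subst (Around _ _ _ _) (reverse-involutive w) (around-reverse ar)

map-suc-pred : (a : Vec ℕ k) → (∀ i → 1 ≤ lookup a i) → a ≡ Vec.map suc (Vec.map pred a)
map-suc-pred []          a≥1 = refl
map-suc-pred (zero ∷ a)  a≥1 = contradiction (a≥1 zero) λ ()
map-suc-pred (suc n ∷ a) a≥1 = cong (suc n ∷_) (map-suc-pred a (a≥1 ∘ suc))

P₁ P₂ : List Pattern
P₁ = (1 ∷ 1 ∷ 2 ∷ []) ∷ (2 ∷ 2 ∷ 1 ∷ 2 ∷ []) ∷ []
P₂ = (1 ∷ 2 ∷ 1 ∷ []) ∷ (2 ∷ 1 ∷ 2 ∷ 2 ∷ []) ∷ []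

module _ (S : Multiset) where

  open Multiset S using (a; aᵢ≥1; size)
  open Admissible

  b : Vec ℕ (Multiset.k S)
  b = Vec.map pred a

  a≡ : a ≡ Vec.map suc b
  a≡ = map-suc-pred a aᵢ≥1

  lookup-a : ∀ i → lookup a i ≡ suc (lookup b i)
  lookup-a i = trans (cong (λ v → lookup v i) a≡) (Vec.lookup-map i suc b)

  isMultipermutation⇔occ : ∀ π → IsMultipermutation S π ⇔ (∀ i → occ i (toList π) ≡ suc (lookup b i))
  isMultipermutation⇔occ π = mk⇔
    (λ multi i → trans (occ-toList i π) (trans (multi i) (lookup-a i)))
    (λ occs i → trans (sym (occ-toList i π)) (trans (occs i) (sym (lookup-a i))))

  avoidingP₁⇔admissible : ∀ π → AvoidingMultipermutation S P₁ π ⇔ Admissible atEnd b (toList π)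
  avoidingP₁⇔admissible π = mk⇔
    (λ { (multi , av112 ∷ av2212 ∷ []) → record
      { multiplicity = Equivalence.to (isMultipermutation⇔occ π) multi
      ; avoidsAbove  = Equivalence.to (avoids-12 1 0 π) av112
      ; avoidsBelow  = Equivalence.to (avoids-21 1 1 π) av2212
      } })
    (λ adm → Equivalence.from (isMultipermutation⇔occ π) (multiplicity adm) ,
      Equivalence.from (avoids-12 1 0 π) (avoidsAbove adm) ∷
      Equivalence.from (avoids-21 1 1 π) (avoidsBelow adm) ∷ [])

  -- Reversal swaps the numbers of copies on the two sides of the single letter: 121 is fixed, and
  -- 2122 becomes 2212.
  avoidingP₂⇔admissible : ∀ π → AvoidingMultipermutation S P₂ π ⇔ Admissible adjacent b (reverse (toList π))
  avoidingP₂⇔admissible π = mk⇔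
    (λ { (multi , av121 ∷ av2122 ∷ []) → record
      { multiplicity = λ i → trans (occ-reverse i (toList π)) (Equivalence.to (isMultipermutation⇔occ π) multi i)
      ; avoidsAbove  = λ d c d<c ar → Equivalence.to (avoids-12 0 1 π) av121 d c d<c (around-unreverse (toList π) ar)
      ; avoidsBelow  = λ d c c<d ar → Equivalence.to (avoids-21 0 2 π) av2122 d c c<d (around-unreverse (toList π) ar)
      } })
    (λ adm → Equivalence.from (isMultipermutation⇔occ π)
        (λ i → trans (sym (occ-reverse i (toList π))) (multiplicity adm i)) ,
      Equivalence.from (avoids-12 0 1 π) (λ d c d<c ar → avoidsAbove adm d c d<c (around-reverse ar)) ∷
      Equivalence.from (avoids-21 0 2 π) (λ d c c<d ar → avoidsBelow adm d c c<d (around-reverse ar)) ∷ [])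

  av-P₁ : av S P₁ ≡ length (allCodes b)
  av-P₁ = count-admissible b (cong Vec.sum a≡) atEnd id (λ _ → refl) (λ _ → refl)
            (avoidingMultipermutation? S P₁) avoidingP₁⇔admissible

  av-P₂ : av S P₂ ≡ length (allCodes b)
  av-P₂ = count-admissible b (cong Vec.sum a≡) adjacent reverse reverse-involutive length-reverse
            (avoidingMultipermutation? S P₂) avoidingP₂⇔admissible

theorem2p11 : ((1 ∷ 1 ∷ 2 ∷ []) ∷ (2 ∷ 2 ∷ 1 ∷ 2 ∷ []) ∷ []) ∼ ((1 ∷ 2 ∷ 1 ∷ []) ∷ (2 ∷ 1 ∷ 2 ∷ 2 ∷ []) ∷ [])
theorem2p11 S = trans (av-P₁ S) (sym (av-P₂ S))
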